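{- For every formula $A$ of higher-order logic, $\vdash_c^{\mathfrak{e}\mathfrak{f}\mathfrak{p}} A^{Ku}\Leftrightarrow A$.
   Context: Syntax. Simple types are generated by: $\iota$ (individuals), $o$ (propositions), and $\tau \to \sigma$ for types $\tau,\sigma$. For each type $\tau$ there are a set $\mathcal{V}_\tau$ of variables (infinitely many, as usual) and a set $\mathcal{C}_\tau$ of constants; variables and constants are disjoint. Terms are simply typed: variables and constants of type $\tau$ are terms of type $\tau$; if $x\in\mathcal{V}_\tau$ and $t$ has type $\sigma$, then $\lambda x.t$ has type $\tau\to\sigma$; if $t$ has type $\tau\to\sigma$ and $u$ has type $\tau$, then $t\,u$ has type $\sigma$. Terms are taken up to renaming of bound variables; $t[x\leftarrow u]$ is capture-avoiding substitution; $\equiv_\beta$ is the congruence generated by $(\lambda x.t)u \hookrightarrow t[x\leftarrow u]$ (no $\eta$). Formulas are terms of type $o$. The constants include $\top,\bot$ of type $o$; $\neg$ of type $o\to o$; $\Rightarrow,\wedge,\vee$ of type $o\to o\to o$; and for every type $\tau$, $\forall_\tau,\exists_\tau$ of type $(\tau\to o)\to o$ and $=_\tau$ of type $\tau\to\tau\to o$ (written infix); there may be further constants. $\forall x.A$ and $\exists x.A$ abbreviate $\forall_\tau(\lambda x.A)$, $\exists_\tau(\lambda x.A)$; $A\Leftrightarrow B := (A\Rightarrow B)\wedge(B\Rightarrow A)$. $FV$ denotes free variables. A context is a finite sequence of formulas. Derivability. Intuitionistic logic has the usual natural deduction rules: introduction and elimination for $\Rightarrow,\wedge,\vee$; Not-I: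 from $\Gamma,A\vdash\bot$ infer $\Gamma\vdash\neg A$; Not-E: from $\Gamma\vdash\neg A$ and $\Gamma\vdash A$ infer $\Gamma\vdash\bot$; Bot-E: from $\Gamma\vdash\bot$ infer $\Gamma\vdash A$; Top-I: $\Gamma\vdash\top$; All-I: from $\Gamma\vdash P\,x$ with $x\notin FV(\Gamma,P)$ infer $\Gamma\vdash\forall P$; All-E: from $\Gamma\vdash\forall P$ infer $\Gamma\vdash P\,t$; Ex-I: from $\Gamma\vdash P\,t$ infer $\Gamma\vdash\exists P$; Ex-E: from $\Gamma\vdash\exists P$ and $\Gamma,P\,x\vdash A$ with $x\notin FV(\Gamma,P,A)$ infer $\Gamma\vdash A$; Ax: $\Gamma,A,\Delta\vdash A$; Conv: from $\Gamma\vdash A$ and $A\equiv_\beta B$ infer $\Gamma\vdash B$. Classical logic adds PEM: $\Gamma\vdash A\vee\neg A$. Equality rules. Eq-I: $\Gamma\vdash u=u$. Eq-E: from $\Gamma\vdash P\,u$ and $\Gamma\vdash u=v$ infer $\Gamma\vdash P\,v$. FunExt: from $\Gamma\vdash f\,x=g\,x$ with $x\notin FV(\Gamma,f,g)$ infer $\Gamma\vdash f=g$. PropExt: from $\Gamma\vdash A\Leftrightarrow B$ infer $\Gamma\vdash A=B$. $\Gamma\vdash_c^{\mathfrak{e}\mathfrak{f}\mathfrak{p}} A$ means that $\Gamma\vdash A$ is derivable in classical logic with the additional rules Eq-I, Eq-E, FunExt and PropExt. Kuroda's translation. For a term $t$, $t_{Ku}$ is defined by: $x_{Ku}:=x$ for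 variables; $(\forall_\tau)_{Ku}:=\lambda p.\forall_\tau(\lambda x.\neg\neg(p\,x))$ for each type $\tau$; $c_{Ku}:=c$ for every other constant; $(\lambda x.t)_{Ku}:=\lambda x.t_{Ku}$; $(t\,u)_{Ku}:=t_{Ku}\,u_{Ku}$. For a formula $A$, $A^{Ku}:=\neg\neg A_{Ku}$. -}

module Defs where

open import Data.List using (List; []; _∷_; [_]; _++_; concatMap)
open import Data.List.Membership.Propositional using (_∈_; _∉_)
open import Data.List.Relation.Unary.Any using (here; there)
open import Data.Product using (∃; _,_)
open import Relation.Binary.PropositionalEquality using (refl)

infixr 20 _⇒_

data Ty : Set where
  ι o : Ty
  _⇒_ : Ty → Ty → Ty

-- 'infinite' is the positive form of "every set of variables is infinite":
-- no finite list exhausts it.  The non-logical constants are arbitrary.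
record Signature : Set₁ where
  field
    Var      : Ty → Set
    infinite : ∀ τ (xs : List (Var τ)) → ∃ λ (x : Var τ) → x ∉ xs
    Extra    : Ty → Set

module HOL (S : Signature) where
  open Signature S

  data Const : Ty → Set where
    top bot     : Const o
    neg         : Const (o ⇒ o)
    imp and or  : Const (o ⇒ o ⇒ o)
    all ex      : ∀ τ → Const ((τ ⇒ o) ⇒ o)
    eq          : ∀ τ → Const (τ ⇒ τ ⇒ o)
    extra       : ∀ {τ} → Extra τ → Const τ

  infixl 9 _·_

  -- Free variables are named, bound ones are de Bruijn indices into Δ, so that
  -- propositional equality of terms is equality up to renaming of bound
  -- variables.  The terms of the language are those with Δ = [].  Keeping named
  -- free variables outside Δ matters: every type has infinitely many of them,
  -- whence  ∀ P  entails  ∃ P  even at a type without closed terms.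
  data Tm (Δ : List Ty) : Ty → Set where
    var : ∀ {τ} → Var τ → Tm Δ τ
    bnd : ∀ {τ} → τ ∈ Δ → Tm Δ τ
    con : ∀ {τ} → Const τ → Tm Δ τ
    ƛ   : ∀ {τ σ} → Tm (τ ∷ Δ) σ → Tm Δ (τ ⇒ σ)
    _·_ : ∀ {τ σ} → Tm Δ (τ ⇒ σ) → Tm Δ τ → Tm Δ σ

  Term : Ty → Set
  Term = Tm []

  Formula : Set
  Formula = Term o

  Context : Set
  Context = List Formula

  FV : ∀ {Δ τ} → Tm Δ τ → List (∃ Var)
  FV (var {τ} x) = [ (τ , x) ]
  FV (bnd i)     = []
  FV (con c)     = []
  FV (ƛ t)       = FV t
  FV (t · u)     = FV t ++ FV u

  infix 4 _∉FV_ _∉FVs_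

  _∉FV_ : ∀ {τ Δ σ} → Var τ → Tm Δ σ → Set
  _∉FV_ {τ} x t = (τ , x) ∉ FV t

  _∉FVs_ : ∀ {τ} → Var τ → Context → Set
  _∉FVs_ {τ} x Γ = (τ , x) ∉ concatMap FV Γ

  Ren : List Ty → List Ty → Set
  Ren Δ Δ′ = ∀ {τ} → τ ∈ Δ → τ ∈ Δ′

  liftᵣ : ∀ {Δ Δ′ τ} → Ren Δ Δ′ → Ren (τ ∷ Δ) (τ ∷ Δ′)
  liftᵣ ρ (here p)  = here p
  liftᵣ ρ (there i) = there (ρ i)

  ren : ∀ {Δ Δ′ τ} → Ren Δ Δ′ → Tm Δ τ → Tm Δ′ τ
  ren ρ (var x) = var x
  ren ρ (bnd i) = bnd (ρ i)
  ren ρ (con c) = con c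
  ren ρ (ƛ t)   = ƛ (ren (liftᵣ ρ) t)
  ren ρ (t · u) = ren ρ t · ren ρ u

  Sub : List Ty → List Ty → Set
  Sub Δ Δ′ = ∀ {τ} → τ ∈ Δ → Tm Δ′ τ

  liftₛ : ∀ {Δ Δ′ τ} → Sub Δ Δ′ → Sub (τ ∷ Δ) (τ ∷ Δ′)
  liftₛ s (here p)  = bnd (here p)
  liftₛ s (there i) = ren there (s i)

  sub : ∀ {Δ Δ′ τ} → Sub Δ Δ′ → Tm Δ τ → Tm Δ′ τ
  sub s (var x) = var x
  sub s (bnd i) = s i
  sub s (con c) = con c
  sub s (ƛ t)   = ƛ (sub (liftₛ s) t)
  sub s (t · u) = sub s t · sub s u

  instantiate : ∀ {Δ τ} → Tm Δ τ → Sub (τ ∷ Δ) Δ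
  instantiate u (here refl) = u
  instantiate u (there i)   = bnd i

  infix 10 _[_]₀

  _[_]₀ : ∀ {Δ τ σ} → Tm (τ ∷ Δ) σ → Tm Δ τ → Tm Δ σ
  t [ u ]₀ = sub (instantiate u) t

  infix 4 _≡β_

  data _≡β_ {Δ} : ∀ {τ} → Tm Δ τ → Tm Δ τ → Set where
    β-step  : ∀ {τ σ} {t : Tm (τ ∷ Δ) σ} {u : Tm Δ τ} → ƛ t · u ≡β t [ u ]₀
    β-refl  : ∀ {τ} {t : Tm Δ τ} → t ≡β t
    β-sym   : ∀ {τ} {t u : Tm Δ τ} → t ≡β u → u ≡β t
    β-trans : ∀ {τ} {t u v : Tm Δ τ} → t ≡β u → u ≡β v → t ≡β v
    β-lam   : ∀ {τ σ} {t t′ : Tm (τ ∷ Δ) σ} → t ≡β t′ → ƛ t ≡β ƛ t′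
    β-app   : ∀ {τ σ} {t t′ : Tm Δ (τ ⇒ σ)} {u u′ : Tm Δ τ} →
              t ≡β t′ → u ≡β u′ → t · u ≡β t′ · u′

  infix  8 _≐_
  infix  7 ~_
  infixr 6 _∧_
  infixr 5 _∨_
  infixr 4 _⊃_
  infix  4 _⇔_

  ⊤ ⊥ : ∀ {Δ} → Tm Δ o
  ⊤ = con top
  ⊥ = con bot

  ~_ : ∀ {Δ} → Tm Δ o → Tm Δ o
  ~ A = con neg · A

  _⊃_ _∧_ _∨_ _⇔_ : ∀ {Δ} → Tm Δ o → Tm Δ o → Tm Δ o
  A ⊃ B = con imp · A · B
  A ∧ B = con and · A · B
  A ∨ B = con or · A · B
  A ⇔ B = (A ⊃ B) ∧ (B ⊃ A)

  _≐_ : ∀ {Δ τ} → Tm Δ τ → Tm Δ τ → Tm Δ o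
  u ≐ v = con (eq _) · u · v

  ∀′ ∃′ : ∀ {Δ τ} → Tm Δ (τ ⇒ o) → Tm Δ o
  ∀′ P = con (all _) · P
  ∃′ P = con (ex _) · P

  infix 2 _⊢_

  data _⊢_ (Γ : Context) : Formula → Set where
    Ax      : ∀ {A} → A ∈ Γ → Γ ⊢ A
    Conv    : ∀ {A B} → Γ ⊢ A → A ≡β B → Γ ⊢ B

    Imp-I   : ∀ {A B} → A ∷ Γ ⊢ B → Γ ⊢ A ⊃ B
    Imp-E   : ∀ {A B} → Γ ⊢ A ⊃ B → Γ ⊢ A → Γ ⊢ B
    And-I   : ∀ {A B} → Γ ⊢ A → Γ ⊢ B → Γ ⊢ A ∧ B
    And-E₁  : ∀ {A B} → Γ ⊢ A ∧ B → Γ ⊢ A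
    And-E₂  : ∀ {A B} → Γ ⊢ A ∧ B → Γ ⊢ B
    Or-I₁   : ∀ {A B} → Γ ⊢ A → Γ ⊢ A ∨ B
    Or-I₂   : ∀ {A B} → Γ ⊢ B → Γ ⊢ A ∨ B
    Or-E    : ∀ {A B C} → Γ ⊢ A ∨ B → A ∷ Γ ⊢ C → B ∷ Γ ⊢ C → Γ ⊢ C
    Not-I   : ∀ {A} → A ∷ Γ ⊢ ⊥ → Γ ⊢ ~ A
    Not-E   : ∀ {A} → Γ ⊢ ~ A → Γ ⊢ A → Γ ⊢ ⊥
    Bot-E   : ∀ {A} → Γ ⊢ ⊥ → Γ ⊢ A
    Top-I   : Γ ⊢ ⊤
    All-I   : ∀ {τ} {P : Term (τ ⇒ o)} (x : Var τ) → x ∉FVs Γ → x ∉FV P →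
              Γ ⊢ P · var x → Γ ⊢ ∀′ P
    All-E   : ∀ {τ} {P : Term (τ ⇒ o)} (t : Term τ) → Γ ⊢ ∀′ P → Γ ⊢ P · t
    Ex-I    : ∀ {τ} {P : Term (τ ⇒ o)} (t : Term τ) → Γ ⊢ P · t → Γ ⊢ ∃′ P
    Ex-E    : ∀ {τ} {P : Term (τ ⇒ o)} {A} (x : Var τ) →
              x ∉FVs Γ → x ∉FV P → x ∉FV A →
              Γ ⊢ ∃′ P → P · var x ∷ Γ ⊢ A → Γ ⊢ A

    PEM     : ∀ {A} → Γ ⊢ A ∨ ~ A

    Eq-I    : ∀ {τ} {u : Term τ} → Γ ⊢ u ≐ u
    Eq-E    : ∀ {τ} (P : Term (τ ⇒ o)) {u v : Term τ} →
              Γ ⊢ P · u → Γ ⊢ u ≐ v → Γ ⊢ P · v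
    FunExt  : ∀ {τ σ} {f g : Term (τ ⇒ σ)} (x : Var τ) →
              x ∉FVs Γ → x ∉FV f → x ∉FV g →
              Γ ⊢ f · var x ≐ g · var x → Γ ⊢ f ≐ g
    PropExt : ∀ {A B : Formula} → Γ ⊢ A ⇔ B → Γ ⊢ A ≐ B

  kuConst : ∀ {Δ τ} → Const τ → Tm Δ τ
  kuConst (all τ) =
    ƛ (∀′ (ƛ (~ ~ (bnd (there (here refl)) · bnd (here refl)))))
  kuConst c       = con c

  ku : ∀ {Δ τ} → Tm Δ τ → Tm Δ τ
  ku (var x) = var x
  ku (bnd i) = bnd i
  ku (con c) = kuConst c
  ku (ƛ t)   = ƛ (ku t)
  ku (t · u) = ku t · ku u

  infix 10 _ᴷᵘ

  _ᴷᵘ : Formula → Formula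
  A ᴷᵘ = ~ ~ ku A

{-# OPTIONS --safe #-}
module Submission where

-- Classical logic with functional and propositional extensionality proves
-- ku t ≐ t for every term t, by induction on t: equality is a congruence,
-- FunExt takes care of abstractions, and for ∀ the predicates λx.¬¬(p x) and p
-- are equal because ¬¬B ⇔ B.  For a formula A, replacing ku A by A in
-- ¬¬(ku A) ⇔ ku A gives the claim.

open import Defs
open import Data.Empty using (⊥-elim)
open import Data.List using (List; []; _∷_; _++_)
open import Data.List.Membership.Propositional using (_∈_)
open import Data.List.Membership.Propositional.Properties using (∈-++⁺ˡ; ∈-++⁺ʳ)
open import Data.List.Relation.Unary.Any using (here; there)
open import Data.Product using (∃; _,_; _×_)
open import Function using (_∘_)
open import Relation.Binary.Definitions using (DecidableEquality)
open import Relation.Binary.PropositionalEquality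
  using (_≡_; refl; sym; trans; cong; cong₂)
open import Relation.Nullary using (yes; no)

infix 4 _≟_

_≟_ : DecidableEquality Ty
ι ≟ ι = yes refl
ι ≟ o = no λ ()
ι ≟ (_ ⇒ _) = no λ ()
o ≟ ι = no λ ()
o ≟ o = yes refl
o ≟ (_ ⇒ _) = no λ ()
(_ ⇒ _) ≟ ι = no λ ()
(_ ⇒ _) ≟ o = no λ ()
(τ ⇒ σ) ≟ (τ′ ⇒ σ′) with τ ≟ τ′ | σ ≟ σ′
... | yes refl | yes refl = yes refl
... | no τ≢τ′  | _        = no λ { refl → τ≢τ′ refl }
... | yes _    | no σ≢σ′  = no λ { refl → σ≢σ′ refl }

module Kuroda (S : Signature) where
  open Signature S
  open HOL S

  variable
    τ σ      : Ty
    Δ Δ′ Δ″ : List Ty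
    Γ        : Context

  -- `FV` lists variables of all types together, while `infinite` avoids lists over a single type;
  -- hence this filter, and the decision procedure for types behind it.
  ofType : ∀ τ → List (∃ Var) → List (Var τ)
  ofType τ []             = []
  ofType τ ((σ , x) ∷ xs) with τ ≟ σ
  ... | yes refl = x ∷ ofType τ xs
  ... | no _     = ofType τ xs

  ∈-ofType : ∀ {x : Var τ} {xs} → (τ , x) ∈ xs → x ∈ ofType τ xs
  ∈-ofType {τ} (here refl) with τ ≟ τ
  ... | yes refl = here refl
  ... | no τ≢τ   = ⊥-elim (τ≢τ refl)
  ∈-ofType {τ} {xs = (σ , _) ∷ _} (there i) with τ ≟ σ
  ... | yes refl = there (∈-ofType i)
  ... | no _     = ∈-ofType i

  fresh : (f : Tm Δ σ) (g : Tm Δ′ σ) → ∃ λ (x : Var τ) → x ∉FV f × x ∉FV g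
  fresh {τ = τ} f g with infinite τ (ofType τ (FV f ++ FV g))
  ... | x , x∉ = x , x∉ ∘ ∈-ofType ∘ ∈-++⁺ˡ , x∉ ∘ ∈-ofType ∘ ∈-++⁺ʳ (FV f)

  -- The composite is a third map tied to the other two only pointwise, so that under `ƛ` the
  -- hypothesis can be re-proved for the lifted maps. The fusion laws below have the same form.
  ren-ren : {ρ : Ren Δ Δ′} {ρ′ : Ren Δ′ Δ″} {ρ″ : Ren Δ Δ″} →
            (∀ {τ} (i : τ ∈ Δ) → ρ′ (ρ i) ≡ ρ″ i) →
            (t : Tm Δ σ) → ren ρ′ (ren ρ t) ≡ ren ρ″ t
  ren-ren h (var x) = refl
  ren-ren h (bnd i) = cong bnd (h i)
  ren-ren h (con c) = refl
  ren-ren h (ƛ t)   = cong ƛ (ren-ren (λ { (here p) → refl ; (there i) → cong there (h i) }) t)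
  ren-ren h (t · u) = cong₂ _·_ (ren-ren h t) (ren-ren h u)

  sub-ren : {ρ : Ren Δ Δ′} {s′ : Sub Δ′ Δ″} {s″ : Sub Δ Δ″} →
            (∀ {τ} (i : τ ∈ Δ) → s′ (ρ i) ≡ s″ i) →
            (t : Tm Δ σ) → sub s′ (ren ρ t) ≡ sub s″ t
  sub-ren h (var x) = refl
  sub-ren h (bnd i) = h i
  sub-ren h (con c) = refl
  sub-ren h (ƛ t)   = cong ƛ (sub-ren (λ { (here p) → refl ; (there i) → cong (ren there) (h i) }) t)
  sub-ren h (t · u) = cong₂ _·_ (sub-ren h t) (sub-ren h u)

  -- Both sides rename along `there ∘ ρ`. In `ren-sub` this settles the outer indices under a
  -- binder.
  ren-liftᵣ-there : (ρ : Ren Δ Δ′) (t : Tm Δ σ) →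
                    ren (liftᵣ {τ = τ} ρ) (ren there t) ≡ ren there (ren ρ t)
  ren-liftᵣ-there ρ t =
    trans (ren-ren {ρ″ = there ∘ ρ} (λ _ → refl) t) (sym (ren-ren (λ _ → refl) t))

  ren-sub : {s : Sub Δ Δ′} {ρ : Ren Δ′ Δ″} {s″ : Sub Δ Δ″} →
            (∀ {τ} (i : τ ∈ Δ) → ren ρ (s i) ≡ s″ i) →
            (t : Tm Δ σ) → ren ρ (sub s t) ≡ sub s″ t
  ren-sub h (var x) = refl
  ren-sub h (bnd i) = h i
  ren-sub h (con c) = refl
  ren-sub {s = s} {ρ} h (ƛ t) = cong ƛ (ren-sub (λ
    { (here p)  → refl
    ; (there i) → trans (ren-liftᵣ-there ρ (s i)) (cong (ren there) (h i)) }) t)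
  ren-sub h (t · u) = cong₂ _·_ (ren-sub h t) (ren-sub h u)

  sub-liftₛ-there : (s : Sub Δ Δ′) (t : Tm Δ σ) →
                    sub (liftₛ {τ = τ} s) (ren there t) ≡ ren there (sub s t)
  sub-liftₛ-there s t =
    trans (sub-ren {s″ = ren there ∘ s} (λ _ → refl) t) (sym (ren-sub (λ _ → refl) t))

  sub-sub : {s : Sub Δ Δ′} {s′ : Sub Δ′ Δ″} {s″ : Sub Δ Δ″} →
            (∀ {τ} (i : τ ∈ Δ) → sub s′ (s i) ≡ s″ i) →
            (t : Tm Δ σ) → sub s′ (sub s t) ≡ sub s″ t
  sub-sub h (var x) = refl
  sub-sub h (bnd i) = h i
  sub-sub h (con c) = refl
  sub-sub {s = s} {s′} h (ƛ t) = cong ƛ (sub-sub (λ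
    { (here p)  → refl
    ; (there i) → trans (sub-liftₛ-there s′ (s i)) (cong (ren there) (h i)) }) t)
  sub-sub h (t · u) = cong₂ _·_ (sub-sub h t) (sub-sub h u)

  sub-id : {s : Sub Δ Δ} → (∀ {τ} (i : τ ∈ Δ) → s i ≡ bnd i) →
           (t : Tm Δ σ) → sub s t ≡ t
  sub-id h (var x) = refl
  sub-id h (bnd i) = h i
  sub-id h (con c) = refl
  sub-id h (ƛ t)   = cong ƛ (sub-id (λ { (here p) → refl ; (there i) → cong (ren there) (h i) }) t)
  sub-id h (t · u) = cong₂ _·_ (sub-id h t) (sub-id h u)

  wk : Tm Δ σ → Tm (τ ∷ Δ) σ
  wk = ren there

  wk-instantiate : (t : Tm Δ σ) (u : Tm Δ τ) → wk t [ u ]₀ ≡ t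
  wk-instantiate t u = trans (sub-ren (λ _ → refl) t) (sub-id (λ _ → refl) t)

  infixl 5 _▸_

  _▸_ : Sub Δ Δ′ → Tm Δ′ τ → Sub (τ ∷ Δ) Δ′
  (s ▸ u) (here refl) = u
  (s ▸ u) (there i)   = s i

  -- Instantiation fills index zero, which lifting left alone, and cancels the weakening of the
  -- other entries. So contracting an instance of an abstraction yields an instance of its body in
  -- the extended environment.
  sub-liftₛ-instantiate : (s : Sub Δ Δ′) (t : Tm (τ ∷ Δ) σ) (u : Tm Δ′ τ) →
                          sub (liftₛ s) t [ u ]₀ ≡ sub (s ▸ u) t
  sub-liftₛ-instantiate s t u =
    sub-sub (λ { (here refl) → refl ; (there i) → wk-instantiate (s i) u }) t

  β-step-≡ : {t : Tm (τ ∷ Δ) σ} {u : Tm Δ τ} {v : Tm Δ σ} → t [ u ]₀ ≡ v → ƛ t · u ≡β v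
  β-step-≡ refl = β-step

  ≐-resp-≡β : {u u′ v v′ : Term τ} → u ≡β u′ → v ≡β v′ → Γ ⊢ u ≐ v → Γ ⊢ u′ ≐ v′
  ≐-resp-≡β p q d = Conv d (β-app (β-app β-refl p) q)

  -- Leibniz's rule for a formula whose hole is index zero: `Eq-E` for the predicate `ƛ C`, with a
  -- β-step on either side.
  replace : (C : Tm (τ ∷ []) o) {u v : Term τ} → Γ ⊢ u ≐ v → Γ ⊢ C [ u ]₀ → Γ ⊢ C [ v ]₀
  replace C e d = Conv (Eq-E (ƛ C) (Conv d (β-sym β-step)) e) β-step

  ·-congˡ : {f g : Term (τ ⇒ σ)} (u : Term τ) → Γ ⊢ f ≐ g → Γ ⊢ f · u ≐ g · u
  ·-congˡ {f = f} {g} u e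
    -- The hole is the function on the right only: filled with `f` the formula is an instance of
    -- reflexivity, filled with `g` it is the goal, once instantiation has cancelled the weakenings.
    with d ← replace (wk (f · u) ≐ bnd (here refl) · wk u) e
    rewrite wk-instantiate f f | wk-instantiate f g | wk-instantiate u f | wk-instantiate u g
    = d Eq-I

  ·-congʳ : (f : Term (τ ⇒ σ)) {u v : Term τ} → Γ ⊢ u ≐ v → Γ ⊢ f · u ≐ f · v
  ·-congʳ f {u} {v} e
    with d ← replace (wk (f · u) ≐ wk f · bnd (here refl)) e
    rewrite wk-instantiate f u | wk-instantiate f v | wk-instantiate u u | wk-instantiate u v
    = d Eq-I

  ≐-trans : {u v w : Term τ} → Γ ⊢ u ≐ v → Γ ⊢ v ≐ w → Γ ⊢ u ≐ w
  ≐-trans {u = u} {v} {w} d e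
    with r ← replace (wk u ≐ bnd (here refl)) e
    rewrite wk-instantiate u v | wk-instantiate u w
    = r d

  -- The premise covers every `x`, so the fresh variable can be chosen here. The empty context
  -- contributes nothing to avoid.
  funExt : {f g : Term (τ ⇒ σ)} → (∀ x → [] ⊢ f · var x ≐ g · var x) → [] ⊢ f ≐ g
  funExt {f = f} {g} h with x , x∉f , x∉g ← fresh f g = FunExt x (λ ()) x∉f x∉g (h x)

  ~~-⇔ : (A : Formula) → Γ ⊢ ~ ~ A ⇔ A
  ~~-⇔ A = And-I
    -- Case distinction on `A`; this is the only use of `PEM`.
    (Imp-I (Or-E PEM (Ax (here refl))
                     (Bot-E (Not-E (Ax (there (here refl))) (Ax (here refl))))))
    (Imp-I (Not-I (Not-E (Ax (here refl)) (Ax (there (here refl))))))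

  kuConst-≐ : (c : Const τ) → [] ⊢ kuConst c ≐ con c
  -- The outer extensionality supplies the predicate `p`, the inner one its argument `x`. Both times
  -- only the left side has a redex to contract.
  kuConst-≐ (all τ) = funExt λ p →
    ≐-resp-≡β (β-sym β-step) β-refl
      (·-congʳ (con (all τ)) (funExt λ x →
        ≐-resp-≡β (β-sym β-step) β-refl (PropExt (~~-⇔ (var p · var x)))))
  kuConst-≐ top       = Eq-I
  kuConst-≐ bot       = Eq-I
  kuConst-≐ neg       = Eq-I
  kuConst-≐ imp       = Eq-I
  kuConst-≐ and       = Eq-I
  kuConst-≐ or        = Eq-I
  kuConst-≐ (ex _)    = Eq-I
  kuConst-≐ (eq _)    = Eq-I
  kuConst-≐ (extra _) = Eq-I

  -- Every index in the image of a constant is bound inside that image, so `s` meets nothing to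
  -- replace. The cases are spelled out because `kuConst` computes only on a known constant.
  sub-kuConst : (s : Sub Δ Δ′) (c : Const τ) → sub s (kuConst c) ≡ kuConst c
  sub-kuConst s (all _)   = refl
  sub-kuConst s top       = refl
  sub-kuConst s bot       = refl
  sub-kuConst s neg       = refl
  sub-kuConst s imp       = refl
  sub-kuConst s and       = refl
  sub-kuConst s or        = refl
  sub-kuConst s (ex _)    = refl
  sub-kuConst s (eq _)    = refl
  sub-kuConst s (extra _) = refl

  -- Only closed terms occur in derivations, so the induction runs over the
  -- closed instances of an open term.
  sub-ku-≐ : (s : Sub Δ []) (t : Tm Δ τ) → [] ⊢ sub s (ku t) ≐ sub s t
  sub-ku-≐ s (var x) = Eq-I
  sub-ku-≐ s (bnd i) = Eq-I
  sub-ku-≐ s (con c) rewrite sub-kuConst s c = kuConst-≐ c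
  -- Applied to `var x`, both abstractions contract to instances of their bodies under `s ▸ var x`,
  -- where the induction hypothesis applies.
  sub-ku-≐ s (ƛ t)   = funExt λ x →
    ≐-resp-≡β (β-sym (β-step-≡ (sub-liftₛ-instantiate s (ku t) (var x))))
              (β-sym (β-step-≡ (sub-liftₛ-instantiate s t (var x))))
              (sub-ku-≐ (s ▸ var x) t)
  sub-ku-≐ s (t · u) =
    ≐-trans (·-congˡ (sub s (ku u)) (sub-ku-≐ s t)) (·-congʳ (sub s t) (sub-ku-≐ s u))

  ku-≐ : (t : Term τ) → [] ⊢ ku t ≐ t
  -- A closed term is its own instance under the identity substitution `bnd`.
  ku-≐ t with e ← sub-ku-≐ bnd t
    rewrite sub-id {s = bnd} (λ _ → refl) (ku t) | sub-id {s = bnd} (λ _ → refl) t = e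

  ᴷᵘ-⇔ : (A : Formula) → [] ⊢ A ᴷᵘ ⇔ A
  ᴷᵘ-⇔ A
    -- The hole is the right side of the equivalence; the `ku A` on the left is weakened and so
    -- survives the replacement.
    with d ← replace (wk (~ ~ ku A) ⇔ bnd (here refl)) (ku-≐ A)
    rewrite wk-instantiate (ku A) (ku A) | wk-instantiate (ku A) A
    = d (~~-⇔ (ku A))

theorem4 : (S : Signature) → let open HOL S in
    (A : Formula) → [] ⊢ A ᴷᵘ ⇔ A
theorem4 S A = Kuroda.ᴷᵘ-⇔ S A
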